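{- Let $G$ be a $2$-connected graph of order at least three. If $\sigma_2(G)\ge 2\widetilde{\alpha}(G)$, then $G$ is hamiltonian (i.e., $G$ contains a cycle through every vertex).
   Context: All graphs are finite and simple. For a graph $G$ that is not complete, $\sigma_2(G)=\min\{d_G(u)+d_G(v): u,v\in V(G),\ u\ne v,\ uv\notin E(G)\}$; if $G$ is complete, $\sigma_2(G)=\infty$. An $(s,t)$-bipartite-hole in $G$ consists of two disjoint vertex sets $S,T\subseteq V(G)$ with $|S|=s$, $|T|=t$ and no edge of $G$ having one endpoint in $S$ and the other in $T$. The bipartite-hole-number $\widetilde{\alpha}(G)$ is the minimum integer $k$ such that there exist positive integers $s,t$ with $s+t=k+1$ for which $G$ contains no $(s,t)$-bipartite-hole. -}

module Defs where

open import Level using (0ℓ)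
open import Data.Nat.Base using (ℕ; zero; suc; _+_; _≤_; _<_; z≤n; s≤s)
open import Data.Nat.Properties using (_≟_; _<?_; anyUpTo?; m≤m+n; m≤n+m; +-comm; 1+n≰n)
open import Data.Fin.Base using (Fin)
open import Data.Fin.Properties using (any?; all?; ¬∀⟶∃¬)
  renaming (_≟_ to _≟ᶠ_)
open import Data.Fin.Subset using (Subset; ∣_∣; _∈_; _∉_; _∩_; Empty)
open import Data.Fin.Subset.Properties using (_∈?_; anySubset?; nonempty?; ∣p∣≤n)
open import Data.List.Base using (List; _∷_; _∷ʳ_; length)
open import Data.List.Membership.Propositional using () renaming (_∈_ to _∈ˡ_)
open import Data.List.Relation.Unary.Linked using (Linked)
open import Data.List.Relation.Unary.Unique.Propositional using (Unique)
open import Data.Product.Base using (_×_; _,_; ∃; ∃₂; proj₁; proj₂)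
open import Data.Vec.Base using (tabulate)
open import Function.Base using (_∘_)
open import Relation.Binary.Construct.Closure.ReflexiveTransitive using (Star)
open import Relation.Binary.Core using (Rel)
open import Relation.Binary.Definitions using (Symmetric; Irreflexive)
  renaming (Decidable to Decidable₂)
open import Relation.Binary.PropositionalEquality using (_≡_; _≢_; refl; subst)
open import Relation.Nullary.Construct.Add.Supremum using (_⁺; ⊤⁺; [_])
open import Relation.Nullary.Decidable using (Dec; yes; no; does; map′; ¬?; _×-dec_; _→-dec_)
open import Relation.Nullary.Negation using (¬_; contradiction)
open import Relation.Unary using (Pred; Decidable)

IsMinimum : Pred ℕ 0ℓ → ℕ → Set
IsMinimum P m = P m × (∀ k → P k → m ≤ k)

minimum : {P : Pred ℕ 0ℓ} → Decidable P → ∀ k → P k → ∃ (IsMinimum P)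
minimum P? zero    p = zero , p , λ _ _ → z≤n
minimum P? (suc k) p with P? zero
... | yes p₀ = zero , p₀ , λ _ _ → z≤n
... | no ¬p₀ with minimum (P? ∘ suc) k p
...   | m , pm , m≤ = suc m , pm , λ where
        zero    q → contradiction q ¬p₀
        (suc j) q → s≤s (m≤ j q)

minimumOf : {P : Pred ℕ 0ℓ} → Decidable P → ∃ P → ∃ (IsMinimum P)
minimumOf P? (k , p) = minimum P? k p

-- Adjacency is required to be decidable: classically this is no
-- restriction, and it is what makes degrees and minima computable.
record Graph (n : ℕ) : Set₁ where
  field
    Adj    : Rel (Fin n) 0ℓ
    _adj?_ : Decidable₂ Adj
    symm   : Symmetric Adj
    irrefl : Irreflexive _≡_ Adj

module _ {n : ℕ} (G : Graph n) where
  open Graph G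

  neighbourhood : Fin n → Subset n
  neighbourhood v = tabulate (λ w → does (v adj? w))

  degree : Fin n → ℕ
  degree v = ∣ neighbourhood v ∣

  Complete : Set
  Complete = ∀ u v → u ≢ v → Adj u v

  AdjAvoiding : Subset n → Rel (Fin n) 0ℓ
  AdjAvoiding X u v = u ∉ X × v ∉ X × Adj u v

  -- The subgraph G - X induced on the complement of X is connected.
  -- (The case where X is everything is excluded in KConnected, as there
  -- ∣ X ∣ < k < n.)
  ConnectedAvoiding : Subset n → Set
  ConnectedAvoiding X = ∀ u v → u ∉ X → v ∉ X → Star (AdjAvoiding X) u v

  KConnected : ℕ → Set
  KConnected k = k < n × (∀ X → ∣ X ∣ < k → ConnectedAvoiding X)

  -- The cycle runs through v, then through vs in order, and back to v.
  record IsCycle (v : Fin n) (vs : List (Fin n)) : Set where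
    field
      length≥3 : 3 ≤ length (v ∷ vs)
      distinct : Unique (v ∷ vs)
      closed   : Linked Adj (v ∷ vs ∷ʳ v)

  Hamiltonian : Set
  Hamiltonian = ∃₂ λ v vs → IsCycle v vs × (∀ w → w ∈ˡ v ∷ vs)

  IsNonadjacentDegreeSum : Pred ℕ 0ℓ
  IsNonadjacentDegreeSum d =
    ∃₂ λ u v → u ≢ v × ¬ Adj u v × degree u + degree v ≡ d

  isNonadjacentDegreeSum? : Decidable IsNonadjacentDegreeSum
  isNonadjacentDegreeSum? d = any? λ u → any? λ v →
    ¬? (u ≟ᶠ v) ×-dec ¬? (u adj? v) ×-dec (degree u + degree v ≟ d)

  complete? : Dec Complete
  complete? = all? λ u → all? λ v → ¬? (u ≟ᶠ v) →-dec (u adj? v)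

  ¬complete⇒sum : ¬ Complete → ∃ IsNonadjacentDegreeSum
  ¬complete⇒sum ¬c =
    let u , ¬u = ¬∀⟶∃¬ n _ (λ u → all? λ v → ¬? (u ≟ᶠ v) →-dec (u adj? v)) ¬c
        v , ¬v = ¬∀⟶∃¬ n _ (λ v → ¬? (u ≟ᶠ v) →-dec (u adj? v)) ¬u
    in degree u + degree v , u , v
     , (λ u≡v → ¬v (λ u≢v → contradiction u≡v u≢v))
     , (λ a → ¬v (λ _ → a))
     , refl

  -- ⊤⁺ plays the role of ∞.
  σ₂ : ℕ ⁺
  σ₂ with complete?
  ... | yes _ = ⊤⁺
  ... | no ¬c = [ proj₁ (minimumOf isNonadjacentDegreeSum? (¬complete⇒sum ¬c)) ]

  BipartiteHole : ℕ → ℕ → Set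
  BipartiteHole s t = ∃₂ λ S T →
    Empty (S ∩ T) × ∣ S ∣ ≡ s × ∣ T ∣ ≡ t ×
    (∀ u v → u ∈ S → v ∈ T → ¬ Adj u v)

  bipartiteHole? : ∀ s t → Dec (BipartiteHole s t)
  bipartiteHole? s t = anySubset? λ S → anySubset? λ T →
    ¬? (nonempty? (S ∩ T)) ×-dec (∣ S ∣ ≟ s) ×-dec (∣ T ∣ ≟ t) ×-dec
    (all? λ u → all? λ v → (u ∈? S) →-dec ((v ∈? T) →-dec ¬? (u adj? v)))

  HasHoleFreeSplit : Pred ℕ 0ℓ
  HasHoleFreeSplit k = ∃₂ λ s t →
    0 < s × 0 < t × s + t ≡ k + 1 × ¬ BipartiteHole s t

  hasHoleFreeSplit? : Decidable HasHoleFreeSplit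
  hasHoleFreeSplit? k = map′
    (λ (s , _ , t , _ , h) → s , t , h)
    (λ (s , t , h@(_ , _ , e , _)) →
        s , s≤s (subst (s ≤_) e (m≤m+n s t))
      , t , s≤s (subst (t ≤_) e (m≤n+m t s)) , h)
    (anyUpTo? (λ s → anyUpTo? (λ t →
      (0 <? s) ×-dec (0 <? t) ×-dec (s + t ≟ k + 1) ×-dec ¬? (bipartiteHole? s t))
      (suc (k + 1))) (suc (k + 1)))

  holeFreeSplit : ∃ HasHoleFreeSplit
  holeFreeSplit = suc n , 1 , suc n , s≤s z≤n , s≤s z≤n , +-comm 1 (suc n)
    , λ (_ , T , _ , _ , ∣T∣≡1+n , _) → 1+n≰n (subst (_≤ n) ∣T∣≡1+n (∣p∣≤n T))

  bipartiteHoleNumber : ℕ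
  bipartiteHoleNumber = proj₁ (minimumOf hasHoleFreeSplit? holeFreeSplit)

{-# OPTIONS --safe #-}
module Submission where

-- Let k be the bipartite-hole-number and s + t = k + 1 with no (s,t)-hole.
-- Without a Hamilton cycle, a longest path v₁ … vₚ has nonadjacent ends, and
-- so has every path on the same vertices.
--
-- If both ends have degree at least k, scan the path until the edges vᵢvᵢ₊₁
-- with v₁ ~ vᵢ₊₁, or those with vₚ ~ vᵢ, first number s. At least t edges of
-- the other kind come later, and rerouting the path shows that suitable
-- endpoints of the former and of the latter are pairwise nonadjacent: a hole.
--
-- Otherwise one end, say v₁, has degree less than k. Vertices of such low
-- degree form a clique, so vₚ is not low. Let C be the maximal initial run of
-- low vertices and h the vertex after it. Rotations keep the end vₚ, so by the
-- first case they only produce low ends; hence a vertex of C that starts a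
-- path through C to h has all its neighbours in C ∪ {h}. Removing the last
-- vertex of C shows that every vertex of C starts such a path, and then h
-- separates C from the rest.

open import Defs
open import Level using (0ℓ)
open import Data.Empty using (⊥; ⊥-elim)
open import Data.Fin.Base using (Fin; zero; suc)
open import Data.Fin.Properties using (any?; all?; ¬∀⟶∃¬) renaming (_≟_ to _≟ᶠ_)
open import Data.Fin.Subset using (Subset; ∣_∣; ⁅_⁆; inside; outside)
  renaming (_∈_ to _∈ₛ_; _∉_ to _∉ₛ_; ⊥ to ∅)
open import Data.Fin.Subset.Properties
  using (∉⊥; ∣⊥∣≡0; ∣⁅x⁆∣≡1; x∈⁅x⁆; x∈⁅y⁆⇒x≡y; x∈p∩q⁻)
open import Data.List.Base
  using (List; []; _∷_; _∷ʳ_; _++_; map; filter; take; upTo; allFin; length; reverse; tabulate)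
open import Data.List.Membership.Propositional using (_∈_; _∉_)
open import Data.List.Membership.Propositional.Properties
  using ( ∈-++⁺ˡ; ∈-++⁺ʳ; ∈-++⁻; ∈-∃++; ∈-filter⁺; ∈-filter⁻; ∈-map⁺; ∈-map⁻
        ; ∈-upTo⁺; ∈-upTo⁻; ∈-allFin)
open import Data.List.Properties
  using (length-map; length-++; length-take; ++-assoc; unfold-reverse; length-tabulate)
open import Data.List.Relation.Unary.All using ([]; _∷_)
open import Data.List.Relation.Unary.All.Properties using (All¬⇒¬Any; ¬Any⇒All¬)
open import Data.List.Relation.Unary.Any using (here; there)
open import Data.List.Relation.Unary.AllPairs using ([]; _∷_)
open import Data.List.Relation.Unary.Linked using (Linked; [-]; _∷_; linked?)
open import Data.List.Relation.Unary.Unique.Propositional using (Unique)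
open import Data.List.Relation.Unary.Unique.Propositional.Properties
  using (filter⁺; upTo⁺; allFin⁺; take⁺; Unique[x∷xs]⇒x∉xs)
open import Data.List.Relation.Binary.Permutation.Propositional
  using (_↭_; ↭-refl; ↭-sym; ↭-trans; ↭-reflexive; ↭⇒↭ₛ; prep)
open import Data.List.Relation.Binary.Permutation.Propositional.Properties
  using (shift; ↭-length; ↭-reverse; ++⁺; ++⁺ˡ; ++⁺ʳ; ∈-resp-↭; ++-comm; ∷↭∷ʳ)
import Data.List.Relation.Binary.Permutation.Setoid.Properties as Permutationₛ
open import Data.Nat.Base
  using (ℕ; zero; suc; _+_; _*_; _≤_; _<_; _≤‴_; ≤‴-reflexive; ≤‴-step; z≤n; s≤s; s≤s⁻¹)
open import Data.Nat.Properties
open import Data.Product.Base using (_×_; _,_; ∃; ∃₂; proj₁; proj₂)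
open import Data.Sum.Base using (_⊎_; inj₁; inj₂)
open import Data.Vec.Base using (_∷_; here; there; _[_]≔_)
  renaming (tabulate to tabulateᵛ)
open import Function.Base using (_∘_)
open import Relation.Binary.Construct.Add.Supremum.NonStrict _≤_ using (_≤⁺_; [≤]-injective)
open import Relation.Binary.Construct.Closure.ReflexiveTransitive using (Star; ε; _◅_)
open import Relation.Binary.Core using (Rel)
open import Relation.Binary.PropositionalEquality
  using (_≡_; _≢_; refl; sym; trans; cong; subst; setoid; ≢-sym)
open import Relation.Nullary.Construct.Add.Supremum using ([_])
open import Relation.Nullary.Decidable using (Dec; yes; no; does; map′; _×-dec_)
open import Relation.Nullary.Negation using (¬_; contradiction)
open import Relation.Unary using (Pred; Decidable)

-- Lists without repetition

Unique-∷ : {A : Set} {x : A} {xs : List A} → x ∉ xs → Unique xs → Unique (x ∷ xs)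
Unique-∷ x∉xs xs! = ¬Any⇒All¬ _ x∉xs ∷ xs!

module _ {A : Set} where

  Unique-resp-↭ : {xs ys : List A} → xs ↭ ys → Unique xs → Unique ys
  Unique-resp-↭ p = Permutationₛ.Unique-resp-↭ (setoid A) (↭⇒↭ₛ p)

  Unique-++⇒≢ : (xs : List A) {ys : List A} {x y : A} →
                Unique (xs ++ ys) → x ∈ xs → y ∈ ys → x ≢ y
  Unique-++⇒≢ (x ∷ xs) xs! (here refl) y∈ refl =
    Unique[x∷xs]⇒x∉xs xs! (∈-++⁺ʳ xs y∈)
  Unique-++⇒≢ (x ∷ xs) (_ ∷ xs!) (there x∈) y∈ = Unique-++⇒≢ xs xs! x∈ y∈

  Unique-++⇒ˡ : (xs : List A) {ys : List A} → Unique (xs ++ ys) → Unique xs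
  Unique-++⇒ˡ []       _          = []
  Unique-++⇒ˡ (x ∷ xs) (x# ∷ xs!) =
    Unique-∷ (All¬⇒¬Any x# ∘ ∈-++⁺ˡ) (Unique-++⇒ˡ xs xs!)

  ∈⇒↭∷ : {x : A} {xs : List A} → x ∈ xs → ∃ λ ys → xs ↭ x ∷ ys
  ∈⇒↭∷ x∈xs with as , bs , refl ← ∈-∃++ x∈xs = as ++ bs , shift _ as bs

  unique-⊆⇒length≤ : {xs ys : List A} → Unique xs → (∀ {x} → x ∈ xs → x ∈ ys) →
                     length xs ≤ length ys
  unique-⊆⇒length≤ {[]}     _   _  = z≤n
  unique-⊆⇒length≤ {x ∷ xs} xs!@(_ ∷ xs!′) xs⊆ys
    with zs , ys↭ ← ∈⇒↭∷ (xs⊆ys (here refl)) =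
    subst (suc (length xs) ≤_) (sym (↭-length ys↭))
      (s≤s (unique-⊆⇒length≤ xs!′ xs⊆zs))
    where
    xs⊆zs : ∀ {y} → y ∈ xs → y ∈ zs
    xs⊆zs y∈ with ∈-resp-↭ ys↭ (xs⊆ys (there y∈))
    ... | here refl = contradiction y∈ (Unique[x∷xs]⇒x∉xs xs!)
    ... | there y∈zs = y∈zs

  map-unique : {B : Set} (f : A → B) {xs : List A} →
               (∀ {x y} → x ∈ xs → y ∈ xs → f x ≡ f y → x ≡ y) →
               Unique xs → Unique (map f xs)
  map-unique f {[]}     _   _ = []
  map-unique f {x ∷ xs} inj xs!@(_ ∷ xs!′) =
    Unique-∷ (λ fx∈ → let y , y∈ , fx≡fy = ∈-map⁻ f fx∈ in
               Unique[x∷xs]⇒x∉xs xs!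
                 (subst (_∈ xs) (sym (inj (here refl) (there y∈) fx≡fy)) y∈))
      (map-unique f (λ x∈ y∈ → inj (there x∈) (there y∈)) xs!′)

module _ {n : ℕ} where

  open import Data.List.Membership.DecPropositional (_≟ᶠ_ {n}) public using (_∈?_)
  open import Data.List.Relation.Unary.Unique.DecPropositional (_≟ᶠ_ {n}) public using (unique?)

  ∃-missing : (xs : List (Fin n)) → length xs < n → ∃ (_∉ xs)
  ∃-missing xs xs<n with all? (_∈? xs)
  ... | no ¬all = ¬∀⟶∃¬ n _ (_∈? xs) ¬all
  ... | yes all = contradiction xs<n (≤⇒≯ (subst (_≤ length xs) (length-tabulate _)
                    (unique-⊆⇒length≤ (allFin⁺ n) (λ {x} _ → all x))))

  Unique⇒length≤ : {xs : List (Fin n)} → Unique xs → length xs ≤ n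
  Unique⇒length≤ {xs} xs! = subst (length xs ≤_) (length-tabulate _)
    (unique-⊆⇒length≤ xs! (λ {x} _ → ∈-allFin x))

  Unique⇒covers : {xs : List (Fin n)} → Unique xs → length xs ≡ n → ∀ w → w ∈ xs
  Unique⇒covers {xs} xs! eq w with w ∈? xs
  ... | yes w∈ = w∈
  ... | no  w∉ = contradiction
    (subst (suc (length xs) ≤_) (sym eq) (Unique⇒length≤ (Unique-∷ w∉ xs!))) 1+n≰n

  -- Makes the existence of a spanning cycle decidable, so that the theorem can be proved by
  -- contradiction.
  anyOfLength? : ∀ d {P : Pred (List (Fin n)) 0ℓ} → Decidable P →
                 Dec (∃ λ xs → length xs ≡ d × P xs)
  anyOfLength? zero    P? = map′ (λ p → [] , refl , p) (λ { ([] , _ , p) → p }) (P? [])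
  anyOfLength? (suc d) P? = map′
    (λ (x , xs , eq , p) → x ∷ xs , cong suc eq , p)
    (λ { (x ∷ xs , eq , p) → x , xs , suc-injective eq , p })
    (any? λ x → anyOfLength? d (P? ∘ (x ∷_)))

-- Subsets listed without repetition

∣insert∣ : ∀ {n} (p : Subset n) x → x ∉ₛ p → ∣ p [ x ]≔ inside ∣ ≡ suc ∣ p ∣
∣insert∣ (inside  ∷ p) zero    x∉ = contradiction here x∉
∣insert∣ (outside ∷ p) zero    x∉ = refl
∣insert∣ (inside  ∷ p) (suc x) x∉ = cong suc (∣insert∣ p x (x∉ ∘ there))
∣insert∣ (outside ∷ p) (suc x) x∉ = ∣insert∣ p x (x∉ ∘ there)

∈-insert⁻ : ∀ {n} (p : Subset n) x {y} → y ∈ₛ p [ x ]≔ inside → y ≡ x ⊎ y ∈ₛ p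
∈-insert⁻ (_ ∷ p) zero    here       = inj₁ refl
∈-insert⁻ (_ ∷ p) zero    (there y∈) = inj₂ (there y∈)
∈-insert⁻ (_ ∷ p) (suc x) here       = inj₂ here
∈-insert⁻ (_ ∷ p) (suc x) (there y∈) with ∈-insert⁻ p x y∈
... | inj₁ refl = inj₁ refl
... | inj₂ y∈p  = inj₂ (there y∈p)

fromList : ∀ {n} {xs : List (Fin n)} → Unique xs →
           ∃ λ (p : Subset n) → ∣ p ∣ ≡ length xs × (∀ {x} → x ∈ₛ p → x ∈ xs)
fromList {n} {[]}     _ = ∅ , ∣⊥∣≡0 n , λ x∈ → contradiction x∈ ∉⊥
fromList {n} {x ∷ xs} xs!@(_ ∷ xs!′) with fromList xs!′
... | p , ∣p∣ , p⊆ = p [ x ]≔ inside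
    , trans (∣insert∣ p x (Unique[x∷xs]⇒x∉xs xs! ∘ p⊆)) (cong suc ∣p∣)
    , λ y∈ → case (∈-insert⁻ p x y∈)
  where
  case : ∀ {y} → y ≡ x ⊎ y ∈ₛ p → y ∈ x ∷ xs
  case (inj₁ refl) = here refl
  case (inj₂ y∈p)  = there (p⊆ y∈p)

-- For `f` the identity this turns `degree` into the length of a filtered list. The general `f` is
-- for the induction.
∣tabulate∣ : ∀ {n} {A : Set} {P : Pred A 0ℓ} (P? : Decidable P) (f : Fin n → A) →
             ∣ tabulateᵛ (does ∘ P? ∘ f) ∣ ≡ length (filter P? (tabulate f))
∣tabulate∣ {zero}  P? f = refl
∣tabulate∣ {suc n} P? f with P? (f zero)
... | yes _ = cong suc (∣tabulate∣ P? (f ∘ suc))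
... | no  _ = ∣tabulate∣ P? (f ∘ suc)

∈-take⇒∈ : ∀ {A : Set} k {xs : List A} {x} → x ∈ take k xs → x ∈ xs
∈-take⇒∈ (suc k) {_ ∷ _} (here px)  = here px
∈-take⇒∈ (suc k) {_ ∷ _} (there x∈) = there (∈-take⇒∈ k x∈)

fromList-∣≡∣ : ∀ {n} {xs : List (Fin n)} → Unique xs → ∀ {k} → k ≤ length xs →
           ∃ λ (p : Subset n) → ∣ p ∣ ≡ k × (∀ {x} → x ∈ₛ p → x ∈ xs)
fromList-∣≡∣ {xs = xs} xs! {k} k≤ with fromList (take⁺ k xs!)
... | p , ∣p∣ , p⊆ =
  p , trans ∣p∣ (trans (length-take k xs) (m≤n⇒m⊓n≡m k≤)) , ∈-take⇒∈ k ∘ p⊆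

-- Selections from initial segments of ℕ

module _ {P : Pred ℕ 0ℓ} (P? : Decidable P) where

  abstract
    below : ℕ → List ℕ
    below m = filter P? (upTo m)

    between : ℕ → ℕ → List ℕ
    between τ m = filter (λ i → (τ ≤? i) ×-dec P? i) (upTo m)

    length-below-zero : length (below 0) ≡ 0
    length-below-zero = refl

    below! : ∀ m → Unique (below m)
    below! m = filter⁺ P? (upTo⁺ m)

    between! : ∀ τ m → Unique (between τ m)
    between! τ m = filter⁺ _ (upTo⁺ m)

    ∈-below⁺ : ∀ {m i} → i < m → P i → i ∈ below m
    ∈-below⁺ i<m = ∈-filter⁺ P? (∈-upTo⁺ i<m)

    ∈-below⁻ : ∀ m {i} → i ∈ below m → i < m × P i
    ∈-below⁻ m i∈ = let i∈′ , p = ∈-filter⁻ P? {xs = upTo m} i∈ in ∈-upTo⁻ i∈′ , p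

    ∈-between⁺ : ∀ {τ m i} → τ ≤ i → i < m → P i → i ∈ between τ m
    ∈-between⁺ {τ} τ≤i i<m p =
      ∈-filter⁺ (λ i → (τ ≤? i) ×-dec P? i) (∈-upTo⁺ i<m) (τ≤i , p)

    ∈-between⁻ : ∀ τ m {i} → i ∈ between τ m → τ ≤ i × i < m × P i
    ∈-between⁻ τ m i∈ =
      let i∈′ , τ≤i , p = ∈-filter⁻ (λ i → (τ ≤? i) ×-dec P? i) {xs = upTo m} i∈
      in τ≤i , ∈-upTo⁻ i∈′ , p

  below-split : ∀ τ m → length (below m) ≤ length (below τ) + length (between τ m)
  below-split τ m = subst (length (below m) ≤_) (length-++ (below τ))
    (unique-⊆⇒length≤ (below! m) sub)
    where
    sub : ∀ {i} → i ∈ below m → i ∈ below τ ++ between τ m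
    sub {i} i∈ with ∈-below⁻ m i∈ | τ ≤? i
    ... | i<m , p | yes τ≤i = ∈-++⁺ʳ (below τ) (∈-between⁺ τ≤i i<m p)
    ... | i<m , p | no  τ≰i = ∈-++⁺ˡ (∈-below⁺ (≰⇒> τ≰i) p)

  below-suc-¬ : ∀ {m} → ¬ P m → length (below (suc m)) ≤ length (below m)
  below-suc-¬ {m} ¬p = unique-⊆⇒length≤ (below! (suc m)) sub
    where
    sub : ∀ {i} → i ∈ below (suc m) → i ∈ below m
    sub i∈ with i<1+m , p ← ∈-below⁻ (suc m) i∈ with m≤n⇒m<n∨m≡n (s≤s⁻¹ i<1+m)
    ... | inj₁ i<m  = ∈-below⁺ i<m p
    ... | inj₂ refl = contradiction p ¬p

-- Two disjoint sets of naturals cannot reach size s at the same moment.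
reach-first : ∀ {P Q : Pred ℕ 0ℓ} (P? : Decidable P) (Q? : Decidable Q) {s} q → 0 < s →
  (∀ {i} → i < q → P i → ¬ Q i) → s ≤ length (below P? q) →
  ∃ λ τ → τ ≤ q ×
    ((s ≤ length (below P? τ) × length (below Q? τ) < s) ⊎
     (s ≤ length (below Q? τ) × length (below P? τ) < s))
reach-first {P} {Q} P? Q? {s} q 0<s disjoint s≤P = case (search q ≤-refl)
  where
  Reached : Set
  Reached = ∃ λ τ → τ ≤ q ×
    ((s ≤ length (below P? τ) × length (below Q? τ) < s) ⊎
     (s ≤ length (below Q? τ) × length (below P? τ) < s))

  search : ∀ m → m ≤ q → (length (below P? m) < s × length (below Q? m) < s) ⊎ Reached
  search zero    _   = inj₁ ( subst (_< s) (sym (length-below-zero P?)) 0<s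
                            , subst (_< s) (sym (length-below-zero Q?)) 0<s)
  search (suc m) m<q with search m (<⇒≤ m<q)
  ... | inj₂ found = inj₂ found
  ... | inj₁ (P<s , Q<s) with P? m
  ...   | yes p with Q<s′ ← ≤-<-trans (below-suc-¬ Q? (disjoint m<q p)) Q<s
                with s ≤? length (below P? (suc m))
  ...     | yes s≤ = inj₂ (suc m , m<q , inj₁ (s≤ , Q<s′))
  ...     | no  s≰ = inj₁ (≰⇒> s≰ , Q<s′)
  search (suc m) m<q | inj₁ (P<s , Q<s)
        | no ¬p with P<s′ ← ≤-<-trans (below-suc-¬ P? ¬p) P<s
                with s ≤? length (below Q? (suc m))
  ...     | yes s≤ = inj₂ (suc m , m<q , inj₂ (s≤ , P<s′))
  ...     | no  s≰ = inj₁ (P<s′ , ≰⇒> s≰)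

  case : (length (below P? q) < s × length (below Q? q) < s) ⊎ Reached → Reached
  case (inj₁ (P<s , _)) = contradiction P<s (≤⇒≯ s≤P)
  case (inj₂ found)     = found

-- Paths

module _ {V : Set} (_~_ : Rel V 0ℓ) where

  infixr 5 _∷_

  -- The vertex list is an index so that reroutings can be compared by `↭`. Vertices may repeat;
  -- distinctness is assumed separately as `Unique`.
  data Path : V → V → List V → Set where
    stop : ∀ v → Path v v (v ∷ [])
    _∷_ : ∀ {u w v xs} → u ~ w → Path w v xs → Path u v (u ∷ xs)

module _ {V : Set} {_~_ : Rel V 0ℓ} where

  start∈ : ∀ {u v xs} → Path _~_ u v xs → u ∈ xs
  start∈ (stop _)   = here refl
  start∈ (_ ∷ _) = here refl

  end∈ : ∀ {u v xs} → Path _~_ u v xs → v ∈ xs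
  end∈ (stop _)   = here refl
  end∈ (_ ∷ π) = there (end∈ π)

  join : ∀ {u v w z xs ys} → Path _~_ u v xs → v ~ w → Path _~_ w z ys →
         Path _~_ u z (xs ++ ys)
  join (stop _)   e ρ = e ∷ ρ
  join (d ∷ π) e ρ = d ∷ join π e ρ

  reverse-path : (∀ {x y} → x ~ y → y ~ x) → ∀ {u v xs} →
                 Path _~_ u v xs → Path _~_ v u (reverse xs)
  reverse-path ~-sym (stop v) = stop v
  reverse-path ~-sym {u} {v} (_∷_ {xs = xs} e π) =
    subst (Path _~_ v u) (sym (unfold-reverse u xs)) (join (reverse-path ~-sym π) (~-sym e) (stop u))

  path-nonempty : ∀ {u v xs} → Path _~_ u v xs → 0 < length xs
  path-nonempty (stop _) = s≤s z≤n
  path-nonempty (_ ∷ _)  = s≤s z≤n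

  ends-distinct : ∀ {u v xs} → Path _~_ u v xs → Unique xs → 1 < length xs → u ≢ v
  ends-distinct (stop _) _   (s≤s ()) _
  ends-distinct (_ ∷ π)  xs! _        refl = Unique[x∷xs]⇒x∉xs xs! (end∈ π)

  -- Used to open a closed path at `c`: with an edge from `v` to `u`, the two pieces rejoin as a
  -- path from `y` to `c`.
  cut-after : ∀ {u v xs c} → Path _~_ u v xs → c ∈ xs →
    c ≡ v ⊎ ∃₂ λ ys zs → ∃ λ y → xs ≡ ys ++ zs × Path _~_ u c ys × c ~ y × Path _~_ y v zs
  cut-after (stop _)   (here refl) = inj₁ refl
  cut-after (e ∷ π) (here refl) = inj₂ (_ , _ , _ , refl , (stop _) , e , π)
  cut-after (e ∷ π) (there c∈) with cut-after π c∈
  ... | inj₁ eq = inj₁ eq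
  ... | inj₂ (ys , zs , y , eq , π₁ , d , π₂) =
    inj₂ (_ ∷ ys , zs , y , cong (_ ∷_) eq , e ∷ π₁ , d , π₂)

  path⇒linked : ∀ {u v w xs} → Path _~_ u v xs → v ~ w → Linked _~_ (xs ∷ʳ w)
  path⇒linked (stop _)             e = e ∷ [-]
  path⇒linked (d ∷ π@(stop _))   e = d ∷ path⇒linked π e
  path⇒linked (d ∷ π@(_ ∷ _))   e = d ∷ path⇒linked π e

  nth : ∀ {u v xs} → Path _~_ u v xs → ℕ → V
  -- Indices beyond the end return the last vertex; adjacency and injectivity therefore need the
  -- bound by `length xs`.
  nth (stop v)        _       = v
  nth (_∷_ {u} _ _)   zero    = u
  nth (_ ∷ π)         (suc i) = nth π i

  nth-start : ∀ {u v xs} (π : Path _~_ u v xs) → nth π 0 ≡ u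
  nth-start (stop _) = refl
  nth-start (_ ∷ _)  = refl

  nth-end : ∀ {u v xs q} (π : Path _~_ u v xs) → length xs ≡ suc q → nth π q ≡ v
  nth-end             (stop _)      _  = refl
  nth-end {q = zero}  (_ ∷ stop _)  ()
  nth-end {q = zero}  (_ ∷ (_ ∷ _)) ()
  nth-end {q = suc q} (_ ∷ π)       eq = nth-end π (suc-injective eq)

  nth-∈ : ∀ {u v xs} (π : Path _~_ u v xs) i → nth π i ∈ xs
  nth-∈ (stop _) _      = here refl
  nth-∈ (_ ∷ _) zero    = here refl
  nth-∈ (_ ∷ π) (suc i) = there (nth-∈ π i)

  nth-step : ∀ {u v xs i} (π : Path _~_ u v xs) → suc i < length xs → nth π i ~ nth π (suc i)
  nth-step (stop _)               (s≤s ())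
  nth-step {i = zero}  (e ∷ π) _         = subst (_ ~_) (sym (nth-start π)) e
  nth-step {i = suc i} (_ ∷ π) (s≤s i<)  = nth-step π i<

  nth-injective : ∀ {u v xs i j} (π : Path _~_ u v xs) → Unique xs →
                  i < length xs → j < length xs → nth π i ≡ nth π j → i ≡ j
  nth-injective {i = zero}  {zero}  _       _   _        _        _  = refl
  nth-injective {i = suc i}         (stop _)   _   (s≤s ()) _        _
  nth-injective {j = suc j}         (stop _)   _   _        (s≤s ()) _
  nth-injective {i = zero}  {suc j} (_ ∷ π) xs! _        _        eq =
    contradiction (subst (_∈ _) (sym eq) (nth-∈ π j)) (Unique[x∷xs]⇒x∉xs xs!)
  nth-injective {i = suc i} {zero}  (_ ∷ π) xs! _        _        eq =
    contradiction (subst (_∈ _) eq (nth-∈ π i)) (Unique[x∷xs]⇒x∉xs xs!)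
  nth-injective {i = suc i} {suc j} (_ ∷ π) (_ ∷ xs!) (s≤s i<) (s≤s j<) eq =
    cong suc (nth-injective π xs! i< j< eq)

  nth-surjective : ∀ {u v xs w} (π : Path _~_ u v xs) → w ∈ xs →
                   ∃ λ i → i < length xs × w ≡ nth π i
  nth-surjective (stop _)   (here refl) = 0 , s≤s z≤n , refl
  nth-surjective (_ ∷ _) (here refl) = 0 , s≤s z≤n , refl
  nth-surjective (_ ∷ π) (there w∈) with nth-surjective π w∈
  ... | i , i< , eq = suc i , s≤s i< , eq

-- Segments of an enumerated path

module Segments {V : Set} {_~_ : Rel V 0ℓ} {q : ℕ} (f : ℕ → V)
  (step : ∀ {i} → i < q → f i ~ f (suc i))
  (injective : ∀ {i j} → i ≤ q → j ≤ q → f i ≡ f j → i ≡ j) where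

  -- A proof of `i ≤‴ j` is built by raising the left end, so recursion on it lists f i, ..., f j in
  -- order, and the list is never empty.
  segment : ∀ {i j} → i ≤‴ j → List V
  segment {i} (≤‴-reflexive _) = f i ∷ []
  segment {i} (≤‴-step p)      = f i ∷ segment p

  segment-path : ∀ {i j} (p : i ≤‴ j) → j ≤ q → Path _~_ (f i) (f j) (segment p)
  segment-path (≤‴-reflexive refl) _   = stop _
  segment-path (≤‴-step p)         j≤q = step (≤-trans (≤‴⇒≤ p) j≤q) ∷ segment-path p j≤q

  ∈-segment⁻ : ∀ {i j w} (p : i ≤‴ j) → w ∈ segment p → ∃ λ k → i ≤ k × k ≤ j × w ≡ f k
  ∈-segment⁻ {i} (≤‴-reflexive refl) (here eq) = i , ≤-refl , ≤-refl , eq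
  ∈-segment⁻ {i} (≤‴-step p)         (here eq) = i , ≤-refl , <⇒≤ (≤‴⇒≤ p) , eq
  ∈-segment⁻     (≤‴-step p)         (there w∈) =
    let k , i<k , k≤j , eq = ∈-segment⁻ p w∈ in k , <⇒≤ i<k , k≤j , eq

  segment! : ∀ {i j} (p : i ≤‴ j) → j ≤ q → Unique (segment p)
  segment! (≤‴-reflexive _) _   = [] ∷ []
  segment! {i} {j} (≤‴-step p) j≤q = Unique-∷ fi∉ (segment! p j≤q)
    where
    fi∉ : f i ∉ segment p
    fi∉ fi∈ = let k , i<k , k≤j , eq = ∈-segment⁻ p fi∈ in
      <⇒≢ i<k (injective (≤-trans (<⇒≤ (≤‴⇒≤ p)) j≤q) (≤-trans k≤j j≤q) eq)

  length-segment : ∀ {i j} (p : i ≤‴ j) → length (segment p) + i ≡ suc j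
  length-segment (≤‴-reflexive refl) = refl
  length-segment {i} (≤‴-step p) = trans (sym (+-suc (length (segment p)) i)) (length-segment p)

  infixr 5 _⊕_

  _⊕_ : ∀ {i k j} → i ≤‴ k → suc k ≤‴ j → i ≤‴ j
  ≤‴-reflexive refl ⊕ p′ = ≤‴-step p′
  ≤‴-step p         ⊕ p′ = ≤‴-step (p ⊕ p′)

  segment-⊕ : ∀ {i k j} (p : i ≤‴ k) (p′ : suc k ≤‴ j) →
              segment (p ⊕ p′) ≡ segment p ++ segment p′
  segment-⊕ (≤‴-reflexive refl) p′ = refl
  segment-⊕ (≤‴-step p)         p′ = cong (_ ∷_) (segment-⊕ p p′)

  -- Permutations preserve distinctness and length; this makes every rerouting a competitor of the
  -- original path.
  spanning : ∀ {xs} (p : 0 ≤‴ q) → xs ↭ segment p → Unique xs × length xs ≡ suc q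
  spanning p xs↭ = Unique-resp-↭ (↭-sym xs↭) (segment! p ≤-refl)
    , trans (↭-length xs↭) (trans (sym (+-identityʳ _)) (length-segment p))

-- Degrees, holes and connectivity through lists

module _ {n : ℕ} (G : Graph n) where
  open Graph G

  degree≤length : ∀ v ys → (∀ {w} → Adj v w → w ∈ ys) → degree G v ≤ length ys
  degree≤length v ys N⊆ys = subst (_≤ length ys) (sym (∣tabulate∣ (v adj?_) (λ w → w)))
    (unique-⊆⇒length≤ (filter⁺ (v adj?_) (allFin⁺ n))
      (λ w∈ → N⊆ys (proj₂ (∈-filter⁻ (v adj?_) {xs = allFin n} w∈))))

  -- The lists may be too long: only their first `s` and `t` entries are kept, and separation passes
  -- to sublists.
  lists⇒hole : ∀ {s t xs ys} → Unique xs → Unique ys → s ≤ length xs → t ≤ length ys →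
               (∀ {x y} → x ∈ xs → y ∈ ys → x ≢ y × ¬ Adj x y) → BipartiteHole G s t
  lists⇒hole xs! ys! s≤ t≤ sep with fromList-∣≡∣ xs! s≤ | fromList-∣≡∣ ys! t≤
  ... | S , ∣S∣ , S⊆ | T , ∣T∣ , T⊆ = S , T
    , (λ (x , x∈) → let x∈S , x∈T = x∈p∩q⁻ S T x∈ in proj₁ (sep (S⊆ x∈S) (T⊆ x∈T)) refl)
    , ∣S∣ , ∣T∣
    , λ _ _ u∈S v∈T → proj₂ (sep (S⊆ u∈S) (T⊆ v∈T))

  images⇒hole : ∀ {s t} (g h : ℕ → Fin n) {is js} → Unique is → Unique js →
    (∀ {i i′} → i ∈ is → i′ ∈ is → g i ≡ g i′ → i ≡ i′) →
    (∀ {j j′} → j ∈ js → j′ ∈ js → h j ≡ h j′ → j ≡ j′) →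
    s ≤ length is → t ≤ length js →
    (∀ {i j} → i ∈ is → j ∈ js → g i ≢ h j × ¬ Adj (g i) (h j)) → BipartiteHole G s t
  images⇒hole g h {is} {js} is! js! g-inj h-inj s≤ t≤ sep = lists⇒hole
    (map-unique g g-inj is!) (map-unique h h-inj js!)
    (subst (_ ≤_) (sym (length-map g is)) s≤) (subst (_ ≤_) (sym (length-map h js)) t≤)
    λ x∈ y∈ → separated (∈-map⁻ g x∈) (∈-map⁻ h y∈)
    where
    separated : ∀ {x y} → (∃ λ i → i ∈ is × x ≡ g i) → (∃ λ j → j ∈ js × y ≡ h j) →
                x ≢ y × ¬ Adj x y
    separated (_ , i∈ , refl) (_ , j∈ , refl) = sep i∈ j∈

  -- Takes the first edge of the walk whose far end is outside `P`.
  exit-edge : ∀ {X u v} {P : Pred (Fin n) 0ℓ} → Decidable P → Star (AdjAvoiding G X) u v →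
              P u → ¬ P v → ∃₂ λ a b → P a × ¬ P b × a ∉ₛ X × b ∉ₛ X × Adj a b
  exit-edge P? ε p ¬p = contradiction p ¬p
  exit-edge P? (_◅_ {j = w} (u∉ , w∉ , e) es) p ¬p with P? w
  ... | no ¬pw = _ , w , p , ¬pw , u∉ , w∉ , e
  ... | yes pw = exit-edge P? es pw ¬p

  GPath : Fin n → Fin n → List (Fin n) → Set
  GPath = Path Adj

-- Longest paths, on `suc q` vertices, in a graph without a Hamilton cycle

module LongestPath {n : ℕ} (G : Graph n) {k s t : ℕ}
  (0<s : 0 < s) (0<t : 0 < t) (s+t≡k+1 : s + t ≡ k + 1) (¬hole : ¬ BipartiteHole G s t)
  (ore : ∀ {u v} → u ≢ v → ¬ Graph.Adj G u v → 2 * k ≤ degree G u + degree G v)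
  (2-connected : ∀ X → ∣ X ∣ < 2 → ConnectedAvoiding G X)
  (3≤n : 3 ≤ n)
  (¬hamiltonian : ∀ {u v xs} → GPath G u v xs → Unique xs → length xs ≡ n → ¬ Graph.Adj G v u)
  {q : ℕ}
  (longest : ∀ {u v xs} → GPath G u v xs → Unique xs → length xs ≢ suc (suc q))
  where

  open Graph G

  private
    P⟨_,_⟩ : Fin n → Fin n → List (Fin n) → Set
    P⟨ u , v ⟩ = GPath G u v

  Low : Pred (Fin n) 0ℓ
  Low v = degree G v < k

  low? : Decidable Low
  low? v = degree G v <? k

  -- Two low degrees sum to less than `2 * k`, against `ore`.
  Low⇒Adj : ∀ {u v} → Low u → Low v → u ≢ v → Adj u v
  Low⇒Adj {u} {v} lu lv u≢v with u adj? v
  ... | yes e = e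
  ... | no ¬e = contradiction (ore u≢v ¬e)
    (<⇒≱ (subst (degree G u + degree G v <_) (cong (k +_) (sym (+-identityʳ k)))
      (+-mono-< lu lv)))

  -- An edge between the ends closes the path to a cycle. If the cycle misses a vertex, connectivity
  -- provides an edge from some `c` on it to some `w` off it; opening the cycle at `c` and adding
  -- `w` gives a longer path.
  ends-nonadjacent : ∀ {u v xs} → P⟨ u , v ⟩ xs → Unique xs → length xs ≡ suc q → ¬ Adj v u
  ends-nonadjacent {u} {v} {xs} π xs! len e with suc q ≟ n
  ... | yes q+1≡n = ¬hamiltonian π xs! (trans len q+1≡n) e
  ... | no  q+1≢n
    with z , z∉ ← ∃-missing xs (≤∧≢⇒< (Unique⇒length≤ xs!) (q+1≢n ∘ trans (sym len)))
    with c , w , c∈ , w∉ , _ , _ , d ← exit-edge G (_∈? xs)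
           (2-connected ∅ (subst (_< 2) (sym (∣⊥∣≡0 n)) (s≤s z≤n)) u z ∉⊥ ∉⊥) (start∈ π) z∉
    with cut-after π c∈
  ... | inj₁ refl = longest (reverse-path symm (join π d (stop w)))
          (Unique-resp-↭ (↭-sym w∷xs↭) (Unique-∷ w∉ xs!)) (trans (↭-length w∷xs↭) (cong suc len))
    where
    w∷xs↭ : reverse (xs ∷ʳ w) ↭ w ∷ xs
    w∷xs↭ = ↭-trans (↭-reverse _) (↭-sym (∷↭∷ʳ w xs))
  ... | inj₂ (ys , zs , y , refl , π₁ , f , π₂) =
    longest (symm d ∷ reverse-path symm (join π₂ e π₁))
      (Unique-resp-↭ (↭-sym w∷xs↭) (Unique-∷ w∉ xs!)) (trans (↭-length w∷xs↭) (cong suc len))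
    where
    w∷xs↭ : w ∷ reverse (zs ++ ys) ↭ w ∷ ys ++ zs
    w∷xs↭ = prep w (↭-trans (↭-reverse _) (++-comm zs ys))

  -- A neighbour off the path could be prepended to it.
  start-neighbours : ∀ {u v xs w} → P⟨ u , v ⟩ xs → Unique xs → length xs ≡ suc q →
                     Adj u w → w ∈ xs
  start-neighbours {xs = xs} {w} π xs! len e with w ∈? xs
  ... | yes w∈ = w∈
  ... | no  w∉ = contradiction (cong suc len) (longest (symm e ∷ π) (Unique-∷ w∉ xs!))

  unique-reverse : ∀ {xs : List (Fin n)} → Unique xs → Unique (reverse xs)
  unique-reverse = Unique-resp-↭ (↭-sym (↭-reverse _))

  end-neighbours : ∀ {u v xs w} → P⟨ u , v ⟩ xs → Unique xs → length xs ≡ suc q →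
                   Adj v w → w ∈ xs
  end-neighbours {xs = xs} π xs! len e = ∈-resp-↭ (↭-reverse xs)
    (start-neighbours (reverse-path symm π) (unique-reverse xs!)
      (trans (↭-length (↭-reverse xs)) len) e)

  -- Two ends of high degree: a bipartite hole

  module HighEnds (f : ℕ → Fin n)
    (step : ∀ {i} → i < q → Adj (f i) (f (suc i)))
    (injective : ∀ {i j} → i ≤ q → j ≤ q → f i ≡ f j → i ≡ j)
    (neighbours₀ : ∀ {w} → Adj (f 0) w → ∃ λ i → i ≤ q × w ≡ f i)
    (neighboursq : ∀ {w} → Adj (f q) w → ∃ λ i → i ≤ q × w ≡ f i)
    (high₀ : k ≤ degree G (f 0)) (highq : k ≤ degree G (f q)) where

    open Segments {_~_ = Adj} f step injective

    -- A number c < q stands for the edge from f c to f (c + 1).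
    A B : Pred ℕ 0ℓ
    A c = Adj (f 0) (f (suc c))
    B c = Adj (f q) (f c)

    A? : Decidable A
    A? c = f 0 adj? f (suc c)

    B? : Decidable B
    B? c = f q adj? f c

    ¬closing : ∀ {u v xs} → P⟨ u , v ⟩ xs → (p : 0 ≤‴ q) → xs ↭ segment p → ¬ Adj v u
    ¬closing π p xs↭ = let xs! , len = spanning p xs↭ in ends-nonadjacent π xs! len

    -- Ore's crossing argument: otherwise f i ... f 0, f (i + 1) ... f q would be a path on the same
    -- vertices with adjacent ends.
    disjoint : ∀ {i} → i < q → A i → ¬ B i
    disjoint {i} i<q a b = ¬closing
      (join (reverse-path symm (segment-path p (<⇒≤ i<q))) a (segment-path p′ ≤-refl))
      (p ⊕ p′)
      (↭-trans (++⁺ʳ (segment p′) (↭-reverse (segment p))) (↭-reflexive (sym (segment-⊕ p p′))))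
      b
      where
      p  = 0≤‴n {i}
      p′ = ≤⇒≤‴ i<q

    -- Rerouting: f i … f 0, f (i + 1) … f j, f q … f (j + 1).
    ¬Adj-A-B : ∀ {i j} → i < j → j < q → A i → B j → ¬ Adj (f i) (f (suc j))
    ¬Adj-A-B {i} {j} i<j j<q a b e = ¬closing
      (join (reverse-path symm (segment-path p (<⇒≤ (<-trans i<j j<q)))) a
        (join (segment-path p′ (<⇒≤ j<q)) (symm b) (reverse-path symm (segment-path p″ ≤-refl))))
      (p ⊕ p′ ⊕ p″)
      (↭-trans (++⁺ (↭-reverse (segment p)) (++⁺ˡ (segment p′) (↭-reverse (segment p″))))
        (↭-reflexive (sym (trans (segment-⊕ p (p′ ⊕ p″)) (cong (segment p ++_) (segment-⊕ p′ p″))))))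
      (symm e)
      where
      p  = 0≤‴n {i}
      p′ = ≤⇒≤‴ i<j
      p″ = ≤⇒≤‴ j<q

    -- Rerouting: f 0 … f i, f q … f (j + 2), f (i + 1) … f (j + 1).
    ¬Adj-B-A : ∀ {i j} → i ≤ j → suc j < q → B i → A j → ¬ Adj (f (suc i)) (f (suc (suc j)))
    ¬Adj-B-A {i} {j} i≤j 1+j<q b a e = ¬closing
      (join (segment-path p (≤-trans i≤j (≤-trans (n≤1+n _) (<⇒≤ 1+j<q)))) (symm b)
        (join (reverse-path symm (segment-path p″ ≤-refl)) (symm e)
          (segment-path p′ (<⇒≤ 1+j<q))))
      (p ⊕ p′ ⊕ p″)
      (↭-trans (++⁺ˡ (segment p) (↭-trans (++-comm (reverse (segment p″)) (segment p′))
                                           (++⁺ˡ (segment p′) (↭-reverse (segment p″)))))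
        (↭-reflexive (sym (trans (segment-⊕ p (p′ ⊕ p″)) (cong (segment p ++_) (segment-⊕ p′ p″))))))
      (symm a)
      where
      p  = 0≤‴n {i}
      p′ = ≤⇒≤‴ (s≤s i≤j)
      p″ = ≤⇒≤‴ 1+j<q

    -- The neighbours of `f 0` all lie on the path and none is `f 0` itself, so each is `f (suc c)`
    -- for some `c` in `A`.
    k≤#A : k ≤ length (below A? q)
    k≤#A = ≤-trans high₀ (subst (degree G (f 0) ≤_) (length-map (f ∘ suc) (below A? q))
      (degree≤length G (f 0) _ λ e → N⊆ e (neighbours₀ e)))
      where
      N⊆ : ∀ {w} → Adj (f 0) w → (∃ λ i → i ≤ q × w ≡ f i) → w ∈ map (f ∘ suc) (below A? q)
      N⊆ e (zero  , _   , refl) = contradiction e (irrefl refl)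
      N⊆ e (suc i , i<q , refl) = ∈-map⁺ (f ∘ suc) (∈-below⁺ A? i<q e)

    k≤#B : k ≤ length (below B? q)
    k≤#B = ≤-trans highq (subst (degree G (f q) ≤_) (length-map f (below B? q))
      (degree≤length G (f q) _ λ e → N⊆ e (neighboursq e)))
      where
      N⊆ : ∀ {w} → Adj (f q) w → (∃ λ i → i ≤ q × w ≡ f i) → w ∈ map f (below B? q)
      N⊆ e (i , i≤q , refl) with m≤n⇒m<n∨m≡n i≤q
      ... | inj₁ i<q  = ∈-map⁺ f (∈-below⁺ B? i<q e)
      ... | inj₂ refl = contradiction e (irrefl refl)

    s≤k : s ≤ k
    s≤k = +-cancelʳ-≤ 1 s k (≤-trans (+-monoʳ-≤ s 0<t) (≤-reflexive s+t≡k+1))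

    -- Here `s + t ≡ k + 1` enters: of at least `k` edges of one kind at most s - 1 come before the
    -- threshold, which leaves at least k - (s - 1) = t.
    t≤rest : ∀ {b c} → k ≤ b + c → b < s → t ≤ c
    t≤rest {b} {c} k≤ b<s = +-cancelˡ-≤ s t c (begin
      s + t       ≡⟨ trans s+t≡k+1 (+-comm k 1) ⟩
      suc k       ≤⟨ s≤s k≤ ⟩
      suc b + c   ≤⟨ +-monoˡ-≤ c b<s ⟩
      s + c       ∎)
      where open ≤-Reasoning

    -- If `suc j` were `q`, then `f 0` would be adjacent to `f q`, the other end of a longest path.
    -- So `f (suc (suc j))` is still on the path.
    A⇒<q : ∀ {j} → j < q → A j → suc j < q
    A⇒<q j<q a with m≤n⇒m<n∨m≡n j<q
    ... | inj₁ 1+j<q = 1+j<q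
    ... | inj₂ refl  = contradiction (symm a)
      (¬closing (segment-path 0≤‴n ≤-refl) 0≤‴n ↭-refl)

    impossible : ⊥
    impossible with reach-first A? B? q 0<s disjoint (≤-trans s≤k k≤#A)
    -- Paired are the predecessors `f i` of early neighbours of `f 0` and the successors `f (suc j)`
    -- of late neighbours of `f q`.
    ... | τ , τ≤q , inj₁ (s≤A , B<s) = ¬hole (images⇒hole G f (f ∘ suc)
      (below! A? τ) (between! B? τ q)
      (λ i∈ i′∈ → injective (bound i∈) (bound i′∈))
      (λ j∈ j′∈ eq → suc-injective (injective (bound′ j∈) (bound′ j′∈) eq))
      s≤A (t≤rest (≤-trans k≤#B (below-split B? τ q)) B<s) separated)
      where
      bound : ∀ {i} → i ∈ below A? τ → i ≤ q
      bound i∈ = <⇒≤ (<-≤-trans (proj₁ (∈-below⁻ A? τ i∈)) τ≤q)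

      bound′ : ∀ {j} → j ∈ between B? τ q → suc j ≤ q
      bound′ j∈ = proj₁ (proj₂ (∈-between⁻ B? τ q j∈))

      separated : ∀ {i j} → i ∈ below A? τ → j ∈ between B? τ q →
                  f i ≢ f (suc j) × ¬ Adj (f i) (f (suc j))
      separated i∈ j∈ =
        let i<τ , a       = ∈-below⁻ A? τ i∈
            τ≤j , j<q , b = ∈-between⁻ B? τ q j∈
            i<j           = <-≤-trans i<τ τ≤j
        in (λ eq → <⇒≢ (m<n⇒m<1+n i<j) (injective (bound i∈) (bound′ j∈) eq))
         , ¬Adj-A-B i<j j<q a b
    -- Here successors are taken on both sides: of early neighbours `f i` of `f q` and of late
    -- neighbours `f (suc j)` of `f 0`.
    ... | τ , τ≤q , inj₂ (s≤B , A<s) = ¬hole (images⇒hole G (f ∘ suc) (λ j → f (suc (suc j)))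
      (below! B? τ) (between! A? τ q)
      (λ i∈ i′∈ eq → suc-injective (injective (bound i∈) (bound i′∈) eq))
      (λ j∈ j′∈ eq → suc-injective (suc-injective (injective (bound′ j∈) (bound′ j′∈) eq)))
      s≤B (t≤rest (≤-trans k≤#A (below-split A? τ q)) A<s) separated)
      where
      bound : ∀ {i} → i ∈ below B? τ → suc i ≤ q
      bound i∈ = <-≤-trans (proj₁ (∈-below⁻ B? τ i∈)) τ≤q

      bound′ : ∀ {j} → j ∈ between A? τ q → suc (suc j) ≤ q
      bound′ j∈ = let _ , j<q , a = ∈-between⁻ A? τ q j∈ in A⇒<q j<q a

      separated : ∀ {i j} → i ∈ below B? τ → j ∈ between A? τ q →
                  f (suc i) ≢ f (suc (suc j)) × ¬ Adj (f (suc i)) (f (suc (suc j)))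
      separated i∈ j∈ =
        let i<τ , b       = ∈-below⁻ B? τ i∈
            τ≤j , j<q , a = ∈-between⁻ A? τ q j∈
            i<j           = <-≤-trans i<τ τ≤j
        in (λ eq → <⇒≢ (s≤s (m<n⇒m<1+n i<j)) (injective (bound i∈) (bound′ j∈) eq))
         , ¬Adj-B-A (<⇒≤ i<j) (A⇒<q j<q a) b a

  ¬high-ends : ∀ {u v xs} → P⟨ u , v ⟩ xs → Unique xs → length xs ≡ suc q →
               ¬ Low u → ¬ Low v → ⊥
  ¬high-ends {u} {v} {xs} π xs! len hu hv = HighEnds.impossible (nth π)
    (λ i<q → nth-step π (index (s≤s i<q)))
    (λ i≤q j≤q → nth-injective π xs! (index (s≤s i≤q)) (index (s≤s j≤q)))
    (λ e → position (start-neighbours π xs! len (subst (λ x → Adj x _) (nth-start π) e)))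
    (λ e → position (end-neighbours π xs! len (subst (λ x → Adj x _) (nth-end π len) e)))
    (≮⇒≥ (subst (λ x → ¬ Low x) (sym (nth-start π)) hu))
    (≮⇒≥ (subst (λ x → ¬ Low x) (sym (nth-end π len)) hv))
    where
    index : ∀ {i} → i < suc q → i < length xs
    index = subst (_ <_) (sym len)
    position : ∀ {w} → w ∈ xs → ∃ λ i → i ≤ q × w ≡ nth π i
    position w∈ = let i , i< , eq = nth-surjective π w∈ in i , s≤s⁻¹ (subst (i <_) len i<) , eq

  -- An end of low degree: a cut vertex

  low-path : ∀ c zs x → Unique (c ∷ zs ∷ʳ x) → (∀ {y} → y ∈ c ∷ zs ∷ʳ x → Low y) →
             P⟨ c , x ⟩ (c ∷ zs ∷ʳ x)
  low-path c [] x xs! low =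
    Low⇒Adj (low (here refl)) (low (there (here refl)))
      (λ eq → Unique[x∷xs]⇒x∉xs xs! (here eq)) ∷ stop x
  low-path c (z ∷ zs) x xs!@(_ ∷ xs!′) low =
    Low⇒Adj (low (here refl)) (low (there (here refl)))
      (λ eq → Unique[x∷xs]⇒x∉xs xs! (here eq)) ∷ low-path z zs x xs!′ (low ∘ there)

  low-prefix : ∀ {u v xs} → P⟨ u , v ⟩ xs → Low u → ¬ Low v →
    ∃₂ λ C D → ∃₂ λ e h → xs ≡ C ++ D × P⟨ u , e ⟩ C × (∀ {x} → x ∈ C → Low x) ×
      Adj e h × ¬ Low h × P⟨ h , v ⟩ D
  low-prefix (stop _) lu hv = contradiction lu hv
  low-prefix (_∷_ {u} {w} a π) lu hv with low? w
  ... | no hw = _ , _ , u , w , refl , stop u , (λ { (here refl) → lu }) , a , hw , π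
  ... | yes lw with low-prefix π lw hv
  ...   | C , D , e , h , refl , πC , low , b , hh , πD =
    u ∷ C , D , e , h , refl , a ∷ πC
    , (λ { (here refl) → lu ; (there x∈) → low x∈ }) , b , hh , πD

  module LowStart {u v e h C D}
    (πC : P⟨ u , e ⟩ C) (e~h : Adj e h) (πD : P⟨ h , v ⟩ D)
    (low : ∀ {x} → x ∈ C → Low x) (¬low-h : ¬ Low h) (¬low-v : ¬ Low v)
    (CD! : Unique (C ++ D)) (len : length (C ++ D) ≡ suc q) where

    C! : Unique C
    C! = Unique-++⇒ˡ C CD!

    ↭⇒unique : ∀ {xs} → xs ↭ C ++ D → Unique xs
    ↭⇒unique xs↭ = Unique-resp-↭ (↭-sym xs↭) CD!

    ↭⇒length : ∀ {xs} → xs ↭ C ++ D → length xs ≡ suc q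
    ↭⇒length xs↭ = trans (↭-length xs↭) len

    -- `C` is a clique, so with the two ends fixed its other vertices may come in any order.
    clique-path : ∀ {c x} → c ∈ C → x ∈ C → c ≢ x → ∃ λ C′ → C′ ↭ C × P⟨ c , x ⟩ C′
    clique-path {c} {x} c∈ x∈ c≢x with as , C↭ ← ∈⇒↭∷ c∈ with ∈-resp-↭ C↭ x∈
    ... | here x≡c = contradiction (sym x≡c) c≢x
    ... | there x∈as with zs , as↭ ← ∈⇒↭∷ x∈as =
      c ∷ zs ∷ʳ x , C′↭C
      , low-path c zs x (Unique-resp-↭ (↭-sym C′↭C) C!) (low ∘ ∈-resp-↭ C′↭C)
      where
      C′↭C : c ∷ zs ∷ʳ x ↭ C
      C′↭C = ↭-sym (↭-trans C↭ (prep c (↭-trans as↭ (∷↭∷ʳ x zs))))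

    -- Otherwise a rotation would produce a path on the same vertices from y
    -- to v, both of which are not low.
    ¬Adj-next : ∀ {c x C′} → P⟨ c , x ⟩ C′ → Adj x h →
      ∀ {y w X Y} → P⟨ h , y ⟩ X → ¬ Low y → P⟨ w , v ⟩ Y → C′ ++ X ++ Y ↭ C ++ D →
      ¬ Adj c w
    ¬Adj-next {C′ = C′} γ x~h {X = X} {Y} πX ¬low-y πY ↭CD c~w =
      ¬high-ends (join (reverse-path symm (join γ x~h πX)) c~w πY)
        (↭⇒unique rotated) (↭⇒length rotated) ¬low-y ¬low-v
      where
      rotated : reverse (C′ ++ X) ++ Y ↭ C ++ D
      rotated = ↭-trans (++⁺ʳ Y (↭-reverse (C′ ++ X)))
        (↭-trans (↭-reflexive (++-assoc C′ X Y)) ↭CD)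

    -- Induction along `Y` with `¬ Low y` as invariant. By `¬Adj-next`, `c` is not adjacent to the
    -- next vertex `w`; as low vertices are pairwise adjacent, `w` is not low and can take over from
    -- `y`.
    ¬Adj-beyond : ∀ {c x C′} → P⟨ c , x ⟩ C′ → Low c → Adj x h →
      ∀ {y w X Y} → P⟨ h , y ⟩ X → ¬ Low y → Adj y w → P⟨ w , v ⟩ Y →
      C′ ++ X ++ Y ↭ C ++ D → ∀ {z} → z ∈ Y → ¬ Adj c z
    ¬Adj-beyond γ low-c x~h πX ¬low-y y~w πY@(stop _) ↭CD (here refl) =
      ¬Adj-next γ x~h πX ¬low-y πY ↭CD
    ¬Adj-beyond γ low-c x~h πX ¬low-y y~w πY@(_ ∷ _) ↭CD (here refl) =
      ¬Adj-next γ x~h πX ¬low-y πY ↭CD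
    ¬Adj-beyond {C′ = C′} γ low-c x~h {w = w} {X} πX ¬low-y y~w
                πY@(_∷_ {xs = Y′} w~w′ πY′) ↭CD (there z∈) =
      ¬Adj-beyond γ low-c x~h (join πX y~w (stop w)) ¬low-w w~w′ πY′
        (↭-trans (↭-reflexive (cong (C′ ++_) (++-assoc X (w ∷ []) Y′))) ↭CD) z∈
      where
      ¬low-w : ¬ Low w
      ¬low-w low-w = ¬Adj-next γ x~h πX ¬low-y πY ↭CD (Low⇒Adj low-c low-w
        (Unique-++⇒≢ C′ (↭⇒unique ↭CD) (start∈ γ) (∈-++⁺ʳ X (start∈ πY))))

    -- `C′` followed by `D` is a longest path, so it contains all neighbours of its start `c`;
    -- `¬Adj-beyond` excludes those after `h`.
    neighbours-via : ∀ {c x C′ w} → P⟨ c , x ⟩ C′ → C′ ↭ C → Adj x h → Adj c w → w ∈ C ⊎ w ≡ h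
    neighbours-via {c} {x} {C′} {w} γ C′↭ x~h c~w
      with ∈-++⁻ C (∈-resp-↭ ↭CD
             (start-neighbours (join γ x~h πD) (↭⇒unique ↭CD) (↭⇒length ↭CD) c~w))
      where
      ↭CD : C′ ++ D ↭ C ++ D
      ↭CD = ++⁺ʳ D C′↭
    ... | inj₁ w∈C = inj₁ w∈C
    ... | inj₂ w∈D = inj₂ (in-D πD w∈D (++⁺ʳ D C′↭))
      where
      in-D : ∀ {D′} → P⟨ h , v ⟩ D′ → w ∈ D′ → C′ ++ D′ ↭ C ++ D → w ≡ h
      in-D (stop _) (here eq)  _    = eq
      in-D (_ ∷ _)  (here eq)  _    = eq
      in-D (a ∷ π)  (there w∈) ↭CD = contradiction c~w
        (¬Adj-beyond γ (low (∈-resp-↭ C′↭ (start∈ γ))) x~h (stop h) ¬low-h a π ↭CD w∈)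

    h∉C : h ∉ C
    h∉C h∈C = ¬low-h (low h∈C)

    e∈C : e ∈ C
    e∈C = end∈ πC

    -- By 2-connectedness a walk from `c` to `z` survives the deletion of `y`, and it has to leave
    -- `C`.
    exit-avoiding : ∀ y {c z} → c ∈ C → z ∉ C → c ≢ y → z ≢ y →
      ∃₂ λ a b → a ∈ C × b ∉ C × a ≢ y × b ≢ y × Adj a b
    exit-avoiding y c∈ z∉ c≢y z≢y
      with exit-edge G (_∈? C)
             (2-connected ⁅ y ⁆ (subst (_< 2) (sym (∣⁅x⁆∣≡1 y)) (s≤s (s≤s z≤n))) _ _
               (c≢y ∘ x∈⁅y⁆⇒x≡y y) (z≢y ∘ x∈⁅y⁆⇒x≡y y)) c∈ z∉
    ... | a , b , a∈ , b∉ , a∉y , b∉y , a~b =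
      a , b , a∈ , b∉ , (λ { refl → a∉y (x∈⁅x⁆ a) }) , (λ { refl → b∉y (x∈⁅x⁆ b) }) , a~b

    -- Deleting `e` leaves an edge out of `C` from some `a ≢ e`. As `a` starts a path through `C` to
    -- `e` and on to `h`, the edge can only lead to `h`.
    second-exit : ∀ {c} → c ∈ C → c ≢ e → ∃ λ c₁ → c₁ ∈ C × c₁ ≢ e × Adj c₁ h
    second-exit c∈ c≢e
      with a , b , a∈ , b∉ , a≢e , _ , a~b ←
             exit-avoiding e c∈ h∉C c≢e (λ { refl → h∉C e∈C })
      with _ , C′↭ , γ ← clique-path a∈ e∈C a≢e
      with neighbours-via γ C′↭ e~h a~b
    ... | inj₁ b∈   = contradiction b∈ b∉
    ... | inj₂ refl = a , a∈ , a≢e , a~b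

    -- Each vertex of `C` starts a path through `C` whose last vertex is adjacent to `h`. For
    -- `c ≢ e` that last vertex is `e`; for `e` itself it is the neighbour of `h` from
    -- `second-exit`.
    neighbours : ∀ {c w} → c ∈ C → Adj c w → w ∈ C ⊎ w ≡ h
    neighbours {c} {w} c∈ c~w with c ≟ᶠ e
    ... | no c≢e = let _ , C′↭ , γ = clique-path c∈ e∈C c≢e in neighbours-via γ C′↭ e~h c~w
    ... | yes refl = last πC C! ↭-refl
      where
      last : ∀ {C′} → P⟨ u , c ⟩ C′ → Unique C′ → C′ ↭ C → w ∈ C ⊎ w ≡ h
      -- `C` is the single vertex `e`, which is already adjacent to `h`.
      last π@(stop _) _   C′↭ = neighbours-via π C′↭ e~h c~w
      last (a ∷ π)    C′! C′↭
        with c₁ , c₁∈ , c₁≢c , c₁~h ←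
               second-exit (∈-resp-↭ C′↭ (here refl))
                 (ends-distinct (a ∷ π) C′! (s≤s (path-nonempty π)))
        with _ , C″↭ , γ ← clique-path c∈ c₁∈ (≢-sym c₁≢c) = neighbours-via γ C″↭ c₁~h c~w

    -- Otherwise `h` would be a cut vertex: a walk from `e` to `z` avoiding `h` leaves `C` by an
    -- edge that `neighbours` forbids.
    C∪h-everything : ∀ {z} → z ∉ C → z ≢ h → ⊥
    C∪h-everything z∉ z≢h
      with a , b , a∈ , b∉ , _ , b≢h , a~b ←
             exit-avoiding h e∈C z∉ (λ { refl → h∉C e∈C }) z≢h
      with neighbours a∈ a~b
    ... | inj₁ b∈  = b∉ b∈
    ... | inj₂ b≡h = b≢h b≡h

    impossible : ⊥
    impossible = by-cases πC πD ↭-refl ↭-refl C!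
      where
      by-cases : ∀ {C′ D′} → P⟨ u , e ⟩ C′ → P⟨ h , v ⟩ D′ → C′ ↭ C → D′ ↭ D → Unique C′ → ⊥
      -- A vertex after `h` on the path lies outside `C` and differs from `h`.
      by-cases _ (_∷_ {xs = D′} a π) _ D′↭ _ = C∪h-everything
        (λ w∈C → Unique-++⇒≢ C CD! w∈C (∈-resp-↭ D′↭ (there (start∈ π))) refl)
        (λ { refl → Unique[x∷xs]⇒x∉xs D′! (start∈ π) })
        where
        D′! : Unique (h ∷ D′)
        D′! = Unique-++⇒ˡ (h ∷ D′) (↭⇒unique (↭-trans (++-comm (h ∷ D′) C) (++⁺ˡ C D′↭)))
      -- The path has only the vertices `u` and `h`, and `3≤n` gives a third.
      by-cases (stop _) (stop _) C′↭ _ _ with z , z∉ ← ∃-missing (u ∷ h ∷ []) 3≤n =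
        C∪h-everything (λ z∈ → z∉ (∈-++⁺ˡ (∈-resp-↭ (↭-sym C′↭) z∈)))
          (λ { refl → z∉ (there (here refl)) })
      -- The path ends at `h`. Some `c₁ ≢ e` in `C` is adjacent to `h`, so reordering `C` to run
      -- from `c₁` to `e` makes the ends adjacent.
      by-cases (a ∷ π) (stop _) C′↭ D′↭ C′!
        with c₁ , c₁∈ , c₁≢e , c₁~h ←
               second-exit (∈-resp-↭ C′↭ (here refl))
                 (ends-distinct (a ∷ π) C′! (s≤s (path-nonempty π)))
        with _ , C″↭ , γ ← clique-path c₁∈ e∈C c₁≢e =
        ends-nonadjacent (join γ e~h (stop h)) (↭⇒unique (++⁺ C″↭ D′↭)) (↭⇒length (++⁺ C″↭ D′↭))
          (symm c₁~h)

  low-start⇒⊥ : ∀ {u v xs} → P⟨ u , v ⟩ xs → Unique xs → length xs ≡ suc q →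
                Low u → ¬ Low v → ⊥
  low-start⇒⊥ π xs! len lu hv with low-prefix π lu hv
  ... | C , D , e , h , refl , πC , low , e~h , ¬low-h , πD =
    LowStart.impossible πC e~h πD low ¬low-h hv xs! len

  ∄-longest : ∀ {u v xs} → P⟨ u , v ⟩ xs → Unique xs → length xs ≡ suc q → u ≢ v → ⊥
  ∄-longest {u} {v} {xs} π xs! len u≢v with low? u | low? v
  ... | yes lu | yes lv = ends-nonadjacent π xs! len (Low⇒Adj lv lu (≢-sym u≢v))
  ... | yes lu | no  hv = low-start⇒⊥ π xs! len lu hv
  ... | no  hu | no  hv = ¬high-ends π xs! len hu hv
  ... | no  hu | yes lv = low-start⇒⊥ (reverse-path symm π) (unique-reverse xs!)
    (trans (↭-length (↭-reverse xs)) len) lv hu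

-- From the contradiction to a Hamilton cycle

module _ {n : ℕ} (G : Graph n) where
  open Graph G

  ore-condition : ∀ {m} → [ m ] ≤⁺ σ₂ G →
                  ∀ {u v} → u ≢ v → ¬ Adj u v → m ≤ degree G u + degree G v
  ore-condition m≤σ₂ {u} {v} u≢v u≁v with complete? G
  ... | yes complete = contradiction (complete u v u≢v) u≁v
  ... | no ¬complete = ≤-trans ([≤]-injective m≤σ₂)
    (proj₂ (proj₂ (minimumOf (isNonadjacentDegreeSum? G) (¬complete⇒sum G ¬complete)))
      _ (u , v , u≢v , u≁v , refl))

  CycleThrough : Fin n → List (Fin n) → Set
  CycleThrough v vs = Unique (v ∷ vs) × Linked Adj (v ∷ vs ∷ʳ v)

  cycleThrough? : ∀ v → Decidable (CycleThrough v)
  cycleThrough? v vs = unique? (v ∷ vs) ×-dec linked? _adj?_ (v ∷ vs ∷ʳ v)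

  path⇒cycle : ∀ {u v xs} → Path Adj u v xs → Adj v u → Unique xs →
               ∃ λ vs → length xs ≡ suc (length vs) × CycleThrough u vs
  path⇒cycle π@(stop _) e xs! = _ , refl , xs! , path⇒linked π e
  path⇒cycle π@(_ ∷ _)  e xs! = _ , refl , xs! , path⇒linked π e

  edge : 3 ≤ n → KConnected G 2 → ∃₂ Adj
  edge (s≤s (s≤s (s≤s _))) (_ , connected)
    with connected ∅ (subst (_< 2) (sym (∣⊥∣≡0 n)) (s≤s z≤n)) zero (suc zero) ∉⊥ ∉⊥
  ... | (_ , _ , e) ◅ _ = _ , _ , e

  -- No longest path is chosen. Instead, for each number of vertices from `n` down to 2, paths with
  -- that many vertices are excluded because none with one more exists; an edge contradicts the last
  -- case.
  ¬¬spanning-cycle : ∀ {k s t} → 0 < s → 0 < t → s + t ≡ k + 1 → ¬ BipartiteHole G s t →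
    (∀ {u v} → u ≢ v → ¬ Adj u v → 2 * k ≤ degree G u + degree G v) →
    KConnected G 2 → 3 ≤ n →
    ¬ (∀ {u v xs} → Path Adj u v xs → Unique xs → length xs ≡ n → ¬ Adj v u)
  ¬¬spanning-cycle 0<s 0<t s+t≡k+1 ¬hole ore 2-conn 3≤n ¬ham
    with u , v , e ← edge 3≤n 2-conn
    with d , 2+d≡n ← m≤n⇒∃[o]m+o≡n (≤-trans (n≤1+n 2) 3≤n) =
    ∄-path d 2+d≡n (e ∷ stop v) (Unique-∷ (λ { (here u≡v) → irrefl u≡v e }) ([] ∷ [])) refl
    where
    -- `d` counts the vertices that a path on `suc (suc q)` vertices misses, so the case of `d`
    -- rests on longer paths. The `q` of `LongestPath` is `suc q` here.
    ∄-path : ∀ d {q} → suc (suc q) + d ≡ n →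
             ∀ {u v xs} → Path Adj u v xs → Unique xs → length xs ≢ suc (suc q)
    ∄-path d {q} eq π xs! len = LongestPath.∄-longest G
      0<s 0<t s+t≡k+1 ¬hole ore (proj₂ 2-conn) 3≤n ¬ham (longest d eq)
      π xs! len (ends-distinct π xs! (≤-trans (s≤s (s≤s z≤n)) (≤-reflexive (sym len))))
      where
      longest : ∀ d → suc (suc q) + d ≡ n →
                ∀ {u v xs} → Path Adj u v xs → Unique xs → length xs ≢ suc (suc (suc q))
      longest zero    eq _ xs! len = 1+n≰n (subst (_ ≤_) (sym (trans (sym (+-identityʳ _)) eq))
        (≤-trans (≤-reflexive (sym len)) (Unique⇒length≤ xs!)))
      longest (suc d) eq = ∄-path d (trans (sym (+-suc _ d)) eq)

hamiltonian : ∀ {n} (G : Graph n) {k} → HasHoleFreeSplit G k →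
  (∀ {u v} → u ≢ v → ¬ Graph.Adj G u v → 2 * k ≤ degree G u + degree G v) →
  KConnected G 2 → 3 ≤ n → Hamiltonian G
hamiltonian {suc n} G (s , t , 0<s , 0<t , s+t≡k+1 , ¬hole) ore 2-conn 3≤n
  -- A spanning cycle is listed as `v` and `n` more vertices, `suc n` in all; there are finitely
  -- many candidates to search.
  with any? (λ v → anyOfLength? n (cycleThrough? G v))
... | yes (v , vs , eq , vs! , closed) = v , vs
  , record { length≥3 = subst (3 ≤_) (cong suc (sym eq)) 3≤n ; distinct = vs! ; closed = closed }
  , Unique⇒covers vs! (cong suc eq)
... | no ¬cycle = ⊥-elim (¬¬spanning-cycle G 0<s 0<t s+t≡k+1 ¬hole ore 2-conn 3≤n
    λ π xs! len e → let vs , eq , cycle = path⇒cycle G π e xs! in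
      ¬cycle (_ , vs , suc-injective (trans (sym eq) len) , cycle))

mainTheorem1 : (n : ℕ) (G : Graph n) → 3 ≤ n → KConnected G 2 →
    [ 2 * bipartiteHoleNumber G ] ≤⁺ σ₂ G → Hamiltonian G
mainTheorem1 n G 3≤n 2-conn 2k≤σ₂ = hamiltonian G {bipartiteHoleNumber G}
  (proj₁ (proj₂ (minimumOf (hasHoleFreeSplit? G) (holeFreeSplit G))))
  (ore-condition G {2 * bipartiteHoleNumber G} 2k≤σ₂) 2-conn 3≤n
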